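{- For an integer $n\geq 1$ define \[a_n=\max\left\{\sum_{i=1}^n (n-i+1)\bigl(1+((i+k)\bmod n)\bigr) : 1\leq k\leq n\right\},\] where $k$ ranges over integers. Then \[a_n=\frac{1}{24}\begin{cases} 7n^3+12n^2+8n, & \text{if } n \text{ is even};\\ 7n^3+12n^2+5n, & \text{otherwise}. \end{cases}\]
   Context: For an integer $j$, $j\bmod n$ denotes the remainder of $j$ upon division by $n$, an element of $\{0,1,\ldots,n-1\}$. -}

module Defs where

open import Data.Bool.Base using (if_then_else_)
open import Data.List.Base using (List; map; upTo)
open import Data.List.Extrema.Nat using (max)
open import Data.Nat.Base using (ℕ; suc; _+_; _*_; _∸_; _^_; _%_; NonZero)
open import Data.Nat.Divisibility using (_∣?_)
open import Data.Nat.ListAction using (sum)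
open import Relation.Nullary.Decidable using (does)

-- The list 1 , 2 , … , n.
range : ℕ → List ℕ
range n = map suc (upTo n)

-- Truncated subtraction is exact here: i only takes values with i ≤ n.
shiftSum : (n : ℕ) .{{_ : NonZero n}} → ℕ → ℕ
shiftSum n k = sum (map (λ i → (n ∸ i + 1) * (1 + (i + k) % n)) (range n))

-- The default value 0 does not affect the maximum: the list is nonempty
-- (n ≥ 1) and its entries are natural numbers.
a : (n : ℕ) .{{_ : NonZero n}} → ℕ
a n = max 0 (map (shiftSum n) (range n))

cubic : ℕ → ℕ
cubic n = if does (2 ∣? n)
  then 7 * n ^ 3 + 12 * n ^ 2 + 8 * n
  else 7 * n ^ 3 + 12 * n ^ 2 + 5 * n

{-# OPTIONS --safe #-}
module Submission where

-- Let 0 ≤ k < n, p = k + 1 and j = n − p.  The residue (i + k) mod n is i + k for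
-- i ≤ j and i − j − 1 for i > j, so the sum splits into two polynomial sums, which
-- add up to n (n + 1) (n + 2) / 6 + n j p / 2.  As j + p = n, the product j p is
-- largest at j = ⌊n/2⌋, p = ⌈n/2⌉.  The shift k = n gives the same sum as k = 0.

open import Defs
import Data.Integer.Properties as ℤ
open import Data.List.Base using (applyUpTo; map)
open import Data.List.Extrema.Nat using (max≈v⁺)
open import Data.List.Membership.Propositional using (_∈_)
open import Data.List.Membership.Propositional.Properties using (∈-map⁺; ∈-upTo⁺)
open import Data.List.Properties using (map-cong; map-upTo; map-applyUpTo)
open import Data.List.Relation.Unary.All.Properties using (applyUpTo⁺₁; map⁺)
open import Data.Nat.Base as ℕ
  using (ℕ; NonZero; zero; suc; _∸_; _%_; _≤_; _<_; z≤n; z<s; s<s; ⌊_/2⌋; ⌈_/2⌉;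
    ≢-nonZero⁻¹; >-nonZero⁻¹)
open import Data.Nat.Divisibility using (_∣_; _∣?_; divides; ∣m+n∣m⇒∣n; ∣1⇒≡1)
open import Data.Nat.DivMod using (m<n⇒m%n≡m; [m+n]%n≡m%n)
open import Data.Nat.ListAction using (sum)
open import Data.Nat.Properties
open import Data.Nat.Tactic.RingSolver using (solve-∀)
open import Data.Product.Base using (_×_; _,_; ∃-syntax)
open import Data.Rational.Properties using (toℚᵘ-fromℚᵘ; toℚᵘ-homo-*; toℚᵘ-injective)
open import Data.Rational.Unnormalised.Base as ℚᵘ using (mkℚᵘ; *≡*)
import Data.Rational.Unnormalised.Properties as ℚᵘ
open import Data.Sum.Base using (_⊎_; inj₁; inj₂)
open import Function.Base using (_∘_)
open import Relation.Binary.PropositionalEquality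
  using (_≡_; refl; sym; trans; cong; cong₂; subst; module ≡-Reasoning)
open import Relation.Nullary.Decidable using (dec-true; dec-false)
open import Relation.Nullary.Negation using (¬_; contradiction)

module _ where

  open import Data.Nat.Base using (_+_; _*_)

  -- Finite sums

  sum-applyUpTo-+ : ∀ (f : ℕ → ℕ) m n →
    sum (applyUpTo f (m + n)) ≡ sum (applyUpTo f m) + sum (applyUpTo (f ∘ (m +_)) n)
  sum-applyUpTo-+ f zero    n = refl
  sum-applyUpTo-+ f (suc m) n = trans
    (cong (f 0 +_) (sum-applyUpTo-+ (f ∘ suc) m n))
    (sym (+-assoc (f 0) _ _))

  sum-applyUpTo-cong : ∀ {f g : ℕ → ℕ} n → (∀ {t} → t < n → f t ≡ g t) →
    sum (applyUpTo f n) ≡ sum (applyUpTo g n)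
  sum-applyUpTo-cong zero    f≗g = refl
  sum-applyUpTo-cong (suc n) f≗g =
    cong₂ _+_ (f≗g z<s) (sum-applyUpTo-cong n (f≗g ∘ s<s))

  -- Expanding the product gives c d m + (c + d) m (m + 1) / 2 + m (m + 1) (m + 2) / 6; the factor 6
  -- clears denominators. Dropping the first term lowers `m` and raises `d` by one, so the induction
  -- needs `d` general.
  6*∑[c+m∸t][d+1+t] : ∀ m c d →
    6 * sum (applyUpTo (λ t → (c + (m ∸ t)) * (d + suc t)) m)
      ≡ 6 * (c * d * m) + 3 * ((c + d) * (m * (1 + m))) + m * (1 + m) * (2 + m)
  6*∑[c+m∸t][d+1+t] zero    c d = solve-zero c d
    where
    solve-zero : ∀ c d → 0 ≡ 6 * (c * d * 0) + 3 * ((c + d) * 0) + 0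
    solve-zero = solve-∀
  6*∑[c+m∸t][d+1+t] (suc m) c d = begin
    6 * (head + sum (applyUpTo (λ t → (c + (m ∸ t)) * (d + suc (suc t))) m))
      ≡⟨ cong (λ s → 6 * (head + s)) (sum-applyUpTo-cong m
           (λ {t} _ → cong ((c + (m ∸ t)) *_) (+-suc d (suc t)))) ⟩
    6 * (head + tail)
      ≡⟨ *-distribˡ-+ 6 head tail ⟩
    6 * head + 6 * tail
      ≡⟨ cong (6 * head +_) (6*∑[c+m∸t][d+1+t] m c (suc d)) ⟩
    6 * head + (6 * (c * suc d * m) + 3 * ((c + suc d) * (m * (1 + m))) + m * (1 + m) * (2 + m))
      ≡⟨ step m c d ⟩
    6 * (c * d * suc m) + 3 * ((c + d) * (suc m * (1 + suc m))) + suc m * (1 + suc m) * (2 + suc m) ∎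
    where
    open ≡-Reasoning
    head = (c + suc m) * (d + 1)
    tail = sum (applyUpTo (λ t → (c + (m ∸ t)) * (suc d + suc t)) m)
    step : ∀ m c d →
      6 * ((c + suc m) * (d + 1)) + (6 * (c * suc d * m) + 3 * ((c + suc d) * (m * (1 + m))) + m * (1 + m) * (2 + m))
      ≡ 6 * (c * d * suc m) + 3 * ((c + d) * (suc m * (1 + suc m))) + suc m * (1 + suc m) * (2 + suc m)
    step = solve-∀

  -- The sum for a single shift

  module _ (n : ℕ) .{{_ : NonZero n}} where

    summand : ℕ → ℕ → ℕ
    summand k i = (n ∸ i + 1) * (1 + (i + k) % n)

    shiftSum≡ : ∀ k → shiftSum n k ≡ sum (applyUpTo (summand k ∘ suc) n)
    shiftSum≡ k = cong sum (trans
      (cong (map (summand k)) (map-upTo suc n))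
      (map-applyUpTo suc (summand k) n))

    -- Translates between the shifts 1, ..., n of the definition and the shifts 0, ..., n - 1 for
    -- which the residues are computed.
    shiftSum-periodic : shiftSum n n ≡ shiftSum n 0
    shiftSum-periodic = cong sum (map-cong
      (λ i → cong (λ r → (n ∸ i + 1) * (1 + r))
        (trans ([m+n]%n≡m%n i n) (cong (_% n) (sym (+-identityʳ i)))))
      (range n))

  n∸[1+t]+1≡n∸t : ∀ {t n} → t < n → n ∸ suc t + 1 ≡ n ∸ t
  n∸[1+t]+1≡n∸t {t} {n} t<n = trans (+-comm (n ∸ suc t) 1) (sym (+-∸-assoc 1 t<n))

  -- 24 times n (n + 1) (n + 2) / 6 + n x / 2, where `x` stands for the product j p.
  closedForm : ℕ → ℕ → ℕ
  closedForm n x = 4 * (n * (1 + n) * (2 + n)) + 12 * (n * x)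

  closedForm-mono-≤ : ∀ n {x y} → x ≤ y → closedForm n x ≤ closedForm n y
  closedForm-mono-≤ n x≤y = +-monoʳ-≤ (4 * (n * (1 + n) * (2 + n))) (*-monoʳ-≤ 12 (*-monoʳ-≤ n x≤y))

  24*shiftSum≡closedForm : ∀ n .{{_ : NonZero n}} j k → j + suc k ≡ n →
    24 * shiftSum n k ≡ closedForm n (j * suc k)
  24*shiftSum≡closedForm n j k refl = begin
    24 * shiftSum n k
      ≡⟨ cong (24 *_) (trans (shiftSum≡ n k) (sum-applyUpTo-+ (summand n k ∘ suc) j p)) ⟩
    24 * (sum (applyUpTo (summand n k ∘ suc) j) + sum (applyUpTo (summand n k ∘ suc ∘ (j +_)) p))
      ≡⟨ cong (24 *_) (cong₂ _+_ (sum-applyUpTo-cong j below) (sum-applyUpTo-cong p above)) ⟩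
    24 * (L + R)
      ≡⟨ regroup L R ⟩
    4 * (6 * L + 6 * R)
      -- Before the wrap both factors are offset by `p`, so c = d = p with `j` terms; after it c = d
      -- = 0 with `p` terms.
      ≡⟨ cong (4 *_) (cong₂ _+_ (6*∑[c+m∸t][d+1+t] j p p) (6*∑[c+m∸t][d+1+t] p 0 0)) ⟩
    4 * (6 * (p * p * j) + 3 * ((p + p) * (j * (1 + j))) + j * (1 + j) * (2 + j)
       + (6 * (0 * 0 * p) + 3 * ((0 + 0) * (p * (1 + p))) + p * (1 + p) * (2 + p)))
      ≡⟨ combine j p ⟩
    closedForm (j + p) (j * p) ∎
    where
    open ≡-Reasoning
    p = suc k
    L = sum (applyUpTo (λ t → (p + (j ∸ t)) * (p + suc t)) j)
    R = sum (applyUpTo (λ t → (0 + (p ∸ t)) * (0 + suc t)) p)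

    below : ∀ {t} → t < j → summand n k (suc t) ≡ (p + (j ∸ t)) * (p + suc t)
    below {t} t<j = cong₂ _*_
      (trans (n∸[1+t]+1≡n∸t (<-≤-trans t<j (m≤m+n j p)))
        (trans (cong (_∸ t) (+-comm j p)) (+-∸-assoc p (<⇒≤ t<j))))
      (trans (cong suc (m<n⇒m%n≡m (+-mono-≤-< t<j (n<1+n k))))
        (cong suc (+-comm (suc t) k)))

    above : ∀ {t} → t < p → summand n k (suc (j + t)) ≡ (p ∸ t) * suc t
    above {t} t<p = cong₂ _*_
      (trans (n∸[1+t]+1≡n∸t (+-monoʳ-< j t<p)) ([m+n]∸[m+o]≡n∸o j p t))
      -- Here i + k = t + n wraps around exactly once, and t < p ≤ n makes `t` the residue.
      (cong suc (trans (cong (_% n) (wrap j t k))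
        (trans ([m+n]%n≡m%n t n) (m<n⇒m%n≡m (<-≤-trans t<p (m≤n+m p j))))))
      where
      wrap : ∀ j t k → suc (j + t) + k ≡ t + (j + suc k)
      wrap = solve-∀

    regroup : ∀ x y → 24 * (x + y) ≡ 4 * (6 * x + 6 * y)
    regroup = solve-∀

    combine : ∀ j p →
      4 * (6 * (p * p * j) + 3 * ((p + p) * (j * (1 + j))) + j * (1 + j) * (2 + j)
       + (6 * (0 * 0 * p) + 3 * ((0 + 0) * (p * (1 + p))) + p * (1 + p) * (2 + p)))
      ≡ 4 * ((j + p) * (1 + (j + p)) * (2 + (j + p))) + 12 * ((j + p) * (j * p))
    combine = solve-∀

  -- Products of two numbers with a fixed sum

  ⌈n/2⌉≡⌊n/2⌋⊎1+⌊n/2⌋ : ∀ n → ⌈ n /2⌉ ≡ ⌊ n /2⌋ ⊎ ⌈ n /2⌉ ≡ suc ⌊ n /2⌋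
  ⌈n/2⌉≡⌊n/2⌋⊎1+⌊n/2⌋ zero          = inj₁ refl
  ⌈n/2⌉≡⌊n/2⌋⊎1+⌊n/2⌋ (suc zero)    = inj₂ refl
  ⌈n/2⌉≡⌊n/2⌋⊎1+⌊n/2⌋ (suc (suc n)) with ⌈n/2⌉≡⌊n/2⌋⊎1+⌊n/2⌋ n
  ... | inj₁ eq = inj₁ (cong suc eq)
  ... | inj₂ eq = inj₂ (cong suc eq)

  module _ {x y h r : ℕ} (h≤r : h ≤ r) (x+y≡h+r : x + y ≡ h + r) where

    -- With h = x + d we get y = r + d, and x y = x r + x d ≤ x r + d r = h r.
    *-balance-≤ : x ≤ h → x * y ≤ h * r
    *-balance-≤ x≤h with m≤n⇒∃[o]m+o≡n x≤h
    ... | d , refl = begin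
      x * y          ≡⟨ cong (x *_) y≡d+r ⟩
      x * (d + r)    ≡⟨ *-distribˡ-+ x d r ⟩
      x * d + x * r  ≤⟨ +-monoˡ-≤ (x * r) (*-monoˡ-≤ d (≤-trans x≤h h≤r)) ⟩
      r * d + x * r  ≡⟨ cong (_+ x * r) (*-comm r d) ⟩
      d * r + x * r  ≡⟨ *-distribʳ-+ r d x ⟨
      (d + x) * r    ≡⟨ cong (_* r) (+-comm d x) ⟩
      (x + d) * r    ∎
      where
      open ≤-Reasoning
      y≡d+r : y ≡ d + r
      y≡d+r = +-cancelˡ-≡ x y (d + r) (trans x+y≡h+r (+-assoc x d r))

  -- One of the two factors is at most ⌊n/2⌋: if `x` exceeds it, then x ≥ ⌈n/2⌉, which forces y ≤
  -- ⌊n/2⌋. The balancing inequality then applies to that factor.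
  x*y≤⌊n/2⌋*⌈n/2⌉ : ∀ x y n → x + y ≡ n → x * y ≤ ⌊ n /2⌋ * ⌈ n /2⌉
  x*y≤⌊n/2⌋*⌈n/2⌉ x y n x+y≡n with ≤-<-connex x ⌊ n /2⌋
  ... | inj₁ x≤h = *-balance-≤ (⌊n/2⌋≤⌈n/2⌉ n) (trans x+y≡n (sym (⌊n/2⌋+⌈n/2⌉≡n n))) x≤h
  ... | inj₂ h<x = subst (_≤ ⌊ n /2⌋ * ⌈ n /2⌉) (*-comm y x)
    (*-balance-≤ (⌊n/2⌋≤⌈n/2⌉ n) (trans (+-comm y x) x+y≡h+r) y≤h)
    where
    x+y≡h+r : x + y ≡ ⌊ n /2⌋ + ⌈ n /2⌉
    x+y≡h+r = trans x+y≡n (sym (⌊n/2⌋+⌈n/2⌉≡n n))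

    ⌈n/2⌉≤x : ⌈ n /2⌉ ≤ x
    ⌈n/2⌉≤x with ⌈n/2⌉≡⌊n/2⌋⊎1+⌊n/2⌋ n
    ... | inj₁ eq = ≤-trans (≤-reflexive eq) (<⇒≤ h<x)
    ... | inj₂ eq = ≤-trans (≤-reflexive eq) h<x

    y≤h : y ≤ ⌊ n /2⌋
    y≤h = +-cancelˡ-≤ ⌈ n /2⌉ y ⌊ n /2⌋ (begin
      ⌈ n /2⌉ + y        ≤⟨ +-monoˡ-≤ y ⌈n/2⌉≤x ⟩
      x + y              ≡⟨ x+y≡h+r ⟩
      ⌊ n /2⌋ + ⌈ n /2⌉  ≡⟨ +-comm ⌊ n /2⌋ ⌈ n /2⌉ ⟩
      ⌈ n /2⌉ + ⌊ n /2⌋  ∎)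
      where open ≤-Reasoning

  -- The cubic by parity

  2∣h+h : ∀ h → 2 ∣ h + h
  2∣h+h h = divides h (h+h≡h*2 h)
    where
    h+h≡h*2 : ∀ h → h + h ≡ h * 2
    h+h≡h*2 = solve-∀

  2∤h+1+h : ∀ h → ¬ 2 ∣ h + suc h
  2∤h+1+h h 2∣n =
    contradiction (∣1⇒≡1 (∣m+n∣m⇒∣n (subst (2 ∣_) (h+1+h≡h+h+1 h) 2∣n) (2∣h+h h))) λ ()
    where
    h+1+h≡h+h+1 : ∀ h → h + suc h ≡ h + h + 1
    h+1+h≡h+h+1 = solve-∀

  cubic-even : ∀ h → cubic (h + h) ≡ closedForm (h + h) (h * h)
  cubic-even h rewrite dec-true (2 ∣? (h + h)) (2∣h+h h) = expand h
    where
    -- Powers appear as `_^_` reduces, leaving only sums and products.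
    expand : ∀ h → 7 * ((h + h) * ((h + h) * ((h + h) * 1))) + 12 * ((h + h) * ((h + h) * 1)) + 8 * (h + h)
      ≡ 4 * ((h + h) * (1 + (h + h)) * (2 + (h + h))) + 12 * ((h + h) * (h * h))
    expand = solve-∀

  cubic-odd : ∀ h → cubic (h + suc h) ≡ closedForm (h + suc h) (h * suc h)
  cubic-odd h rewrite dec-false (2 ∣? (h + suc h)) (2∤h+1+h h) = expand h
    where
    expand : ∀ h → 7 * ((h + suc h) * ((h + suc h) * ((h + suc h) * 1)))
      + 12 * ((h + suc h) * ((h + suc h) * 1)) + 5 * (h + suc h)
      ≡ 4 * ((h + suc h) * (1 + (h + suc h)) * (2 + (h + suc h))) + 12 * ((h + suc h) * (h * suc h))
    expand = solve-∀

  cubic≡closedForm : ∀ n → cubic n ≡ closedForm n (⌊ n /2⌋ * ⌈ n /2⌉)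
  cubic≡closedForm n = helper ⌊ n /2⌋ ⌈ n /2⌉ (⌊n/2⌋+⌈n/2⌉≡n n) (⌈n/2⌉≡⌊n/2⌋⊎1+⌊n/2⌋ n)
    where
    -- The halves become variables `h` and `r`, so that the equations can be matched with `refl`.
    helper : ∀ {n} h r → h + r ≡ n → r ≡ h ⊎ r ≡ suc h → cubic n ≡ closedForm n (h * r)
    helper h _ refl (inj₁ refl) = cubic-even h
    helper h _ refl (inj₂ refl) = cubic-odd h

  -- The maximum over all shifts

  module _ (n : ℕ) .{{_ : NonZero n}} where

    k<n⇒24*shiftSum≤cubic : ∀ {k} → k < n → 24 * shiftSum n k ≤ cubic n
    k<n⇒24*shiftSum≤cubic {k} k<n = begin
      24 * shiftSum n k              ≡⟨ 24*shiftSum≡closedForm n (n ∸ suc k) k j+p≡n ⟩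
      closedForm n ((n ∸ suc k) * suc k)  ≤⟨ closedForm-mono-≤ n (x*y≤⌊n/2⌋*⌈n/2⌉ (n ∸ suc k) (suc k) n j+p≡n) ⟩
      closedForm n (⌊ n /2⌋ * ⌈ n /2⌉)    ≡⟨ cubic≡closedForm n ⟨
      cubic n                        ∎
      where
      open ≤-Reasoning
      j+p≡n : n ∸ suc k + suc k ≡ n
      j+p≡n = m∸n+n≡m k<n

    k≤n⇒24*shiftSum≤cubic : ∀ {k} → k ≤ n → 24 * shiftSum n k ≤ cubic n
    k≤n⇒24*shiftSum≤cubic {k} k≤n with m≤n⇒m<n∨m≡n k≤n
    ... | inj₁ k<n = k<n⇒24*shiftSum≤cubic k<n
    ... | inj₂ k≡n = subst (λ s → 24 * s ≤ cubic n)
      (sym (trans (cong (shiftSum n) k≡n) (shiftSum-periodic n)))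
      (k<n⇒24*shiftSum≤cubic (>-nonZero⁻¹ n))

    -- The shift 0 is not in `range n`, but its sum occurs there as that of the shift `n`.
    shiftSum∈ : ∀ {k} → k < n → shiftSum n k ∈ map (shiftSum n) (range n)
    shiftSum∈ {zero}  0<n = subst (_∈ map (shiftSum n) (range n))
      (trans (cong (shiftSum n) (suc-pred n)) (shiftSum-periodic n))
      (∈-map⁺ (shiftSum n) (∈-map⁺ suc (∈-upTo⁺ (≤-reflexive (suc-pred n)))))
    shiftSum∈ {suc k} k<n = ∈-map⁺ (shiftSum n) (∈-map⁺ suc (∈-upTo⁺ (<-trans (n<1+n k) k<n)))

    -- The shift is k = ⌈n/2⌉ - 1, for which p = ⌈n/2⌉ and j = ⌊n/2⌋; ⌈n/2⌉ = 0 would force n = 0.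
    maximiser : ∃[ k ] k < n × 24 * shiftSum n k ≡ cubic n
    maximiser with ⌈ n /2⌉ | ⌊n/2⌋+⌈n/2⌉≡n n | cubic≡closedForm n | ⌊n/2⌋≤⌈n/2⌉ n
    ... | zero  | h+0≡n | _  | h≤0 = contradiction
      (trans (sym h+0≡n) (trans (+-identityʳ _) (n≤0⇒n≡0 h≤0))) (≢-nonZero⁻¹ n)
    ... | suc k | h+r≡n | eq | _   =
      k , subst (k <_) h+r≡n (m≤n+m (suc k) ⌊ n /2⌋) ,
      trans (24*shiftSum≡closedForm n ⌊ n /2⌋ k h+r≡n) (sym eq)

    24*a≡cubic : 24 * a n ≡ cubic n
    24*a≡cubic with maximiser
    ... | k , k<n , eq = trans (cong (24 *_) a≡shiftSum) eq
      where
      a≡shiftSum : a n ≡ shiftSum n k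
      a≡shiftSum = max≈v⁺ (shiftSum∈ k<n)
        -- The entry at `t` has shift `suc t`, and `t<n` is by definition `suc t ≤ n`. The final
        -- `z≤n` bounds the default 0 of `max`.
        (map⁺ (map⁺ (applyUpTo⁺₁ _ n (λ t<n →
          *-cancelˡ-≤ 24 (≤-trans (k≤n⇒24*shiftSum≤cubic t<n) (≤-reflexive (sym eq)))))))
        z≤n

-- Passage to the rationals

open import Data.Integer.Base as ℤ using (+_)
open import Data.Rational.Base using (_/_; _*_; toℚᵘ)

-- Among unnormalised fractions equality is cross multiplication, which reduces the claim to the
-- hypothesis; `toℚᵘ` is injective, so it transfers back.
d*k≡m⇒k≡1/d*m : ∀ d-1 k m → suc d-1 ℕ.* k ≡ m →
  (+ k) / 1 ≡ ((+ 1) / suc d-1) * ((+ m) / 1)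
d*k≡m⇒k≡1/d*m d-1 k m d*k≡m = toℚᵘ-injective (begin
  toℚᵘ ((+ k) / 1)                              ≈⟨ toℚᵘ-fromℚᵘ (mkℚᵘ (+ k) 0) ⟩
  mkℚᵘ (+ k) 0                                  ≈⟨ *≡* cross ⟩
  mkℚᵘ (+ 1) d-1 ℚᵘ.* mkℚᵘ (+ m) 0              ≈⟨ ℚᵘ.*-cong (toℚᵘ-fromℚᵘ (mkℚᵘ (+ 1) d-1)) (toℚᵘ-fromℚᵘ (mkℚᵘ (+ m) 0)) ⟨
  toℚᵘ ((+ 1) / suc d-1) ℚᵘ.* toℚᵘ ((+ m) / 1)  ≈⟨ toℚᵘ-homo-* ((+ 1) / suc d-1) ((+ m) / 1) ⟨
  toℚᵘ (((+ 1) / suc d-1) * ((+ m) / 1))        ∎)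
  where
  open ℚᵘ.≃-Reasoning
  cross : (+ k) ℤ.* (+ (suc d-1 ℕ.* 1)) ≡ (+ 1) ℤ.* (+ m) ℤ.* (+ 1)
  cross = trans (sym (ℤ.pos-* k (suc d-1 ℕ.* 1)))
    (trans (cong +_ (trans (cong (k ℕ.*_) (*-identityʳ (suc d-1))) (trans (*-comm k (suc d-1)) d*k≡m)))
      (sym (trans (ℤ.*-identityʳ _) (ℤ.*-identityˡ _))))

theorem6 : (n : ℕ) .{{_ : NonZero n}} →
    (+ a n) / 1 ≡ ((+ 1) / 24) * ((+ cubic n) / 1)
theorem6 n = d*k≡m⇒k≡1/d*m 23 (a n) (cubic n) (24*a≡cubic n)
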